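{- Let $\{a,b,c\}$ with $a<b<c$ be a $D(4)$-triple, and let $r=\sqrt{ab+4}$, $s=\sqrt{ac+4}$, $t=\sqrt{bc+4}$. Suppose that $r,s,t$ are the side lengths of a non-degenerate triangle. Then $$r^2+s^2-t^2=r^2-(b-a)(2r+a+b),$$ and exactly one of the following three cases holds for the triangle with side lengths $r,s,t$: (1) it is acute if and only if $r^2>(b-a)(2r+a+b)$; (2) it is right if and only if $r^2=(b-a)(2r+a+b)$; (3) it is obtuse if and only if $r^2<(b-a)(2r+a+b)$.
   Context: A $D(4)$-triple is a set of three distinct positive integers such that the product of any two distinct elements, increased by $4$, is a perfect square. The numbers $r,s,t$ are then positive integers with $r<s<t$, so they are the side lengths of a non-degenerate triangle exactly when $r+s>t$. -}

module Defs where

open import Data.Nat as ℕ using (ℕ; NonZero)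
open import Data.Nat.Properties using (m*n≢0)
open import Data.Integer as ℤ using (+_)
open import Data.Rational as ℚ using (ℚ; 0ℚ)
open import Data.Product using (_×_; ∃)
open import Data.Sum using (_⊎_)
open import Relation.Nullary using (¬_)
open import Relation.Binary.PropositionalEquality using (_≡_; _≢_)

IsSquare : ℕ → Set
IsSquare n = ∃ λ k → k ℕ.^ 2 ≡ n

record IsD4Triple (a b c : ℕ) : Set where
  field
    a>0 : 0 ℕ.< a
    b>0 : 0 ℕ.< b
    c>0 : 0 ℕ.< c
    a≢b : a ≢ b
    a≢c : a ≢ c
    b≢c : b ≢ c
    ab+4-square : IsSquare (a ℕ.* b ℕ.+ 4)
    ac+4-square : IsSquare (a ℕ.* c ℕ.+ 4)
    bc+4-square : IsSquare (b ℕ.* c ℕ.+ 4)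

-- Cosine, by the law of cosines, of the angle between sides x and y
-- in a triangle whose third side is z.
cosine : (x y z : ℕ) .{{_ : NonZero x}} .{{_ : NonZero y}} → ℚ
cosine x y z =
  ((+ x) ℤ.^ 2 ℤ.+ (+ y) ℤ.^ 2 ℤ.- (+ z) ℤ.^ 2) ℚ./ (2 ℕ.* (x ℕ.* y))
  where
    instance
      xy≢0 : NonZero (x ℕ.* y)
      xy≢0 = m*n≢0 x y
      2xy≢0 : NonZero (2 ℕ.* (x ℕ.* y))
      2xy≢0 = m*n≢0 2 (x ℕ.* y)

record IsTriangle (x y z : ℕ) : Set where
  field
    {{x≢0}} : NonZero x
    {{y≢0}} : NonZero y
    {{z≢0}} : NonZero z
    x<y+z   : x ℕ.< y ℕ.+ z
    y<x+z   : y ℕ.< x ℕ.+ z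
    z<x+y   : z ℕ.< x ℕ.+ y

  cosX cosY cosZ : ℚ
  cosX = cosine y z x
  cosY = cosine x z y
  cosZ = cosine x y z

-- An angle θ ∈ (0 , π) is acute, right or obtuse according to whether
-- cos θ is positive, zero or negative.
AcuteAngle RightAngle ObtuseAngle : ℚ → Set
AcuteAngle  cosθ = 0ℚ ℚ.< cosθ
RightAngle  cosθ = cosθ ≡ 0ℚ
ObtuseAngle cosθ = cosθ ℚ.< 0ℚ

module _ {x y z : ℕ} (T : IsTriangle x y z) where
  open IsTriangle T

  Acute : Set
  Acute = AcuteAngle cosX × AcuteAngle cosY × AcuteAngle cosZ

  Right : Set
  Right = RightAngle cosX ⊎ RightAngle cosY ⊎ RightAngle cosZ

  Obtuse : Set
  Obtuse = ObtuseAngle cosX ⊎ ObtuseAngle cosY ⊎ ObtuseAngle cosZ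

ExactlyOne : (P Q R : Set) → Set
ExactlyOne P Q R = (P ⊎ Q ⊎ R) × ¬ (P × Q) × ¬ (P × R) × ¬ (Q × R)

{-# OPTIONS --safe #-}
module Submission where

-- Put D = 2(a + b + c) + abc − rst, 2x = rs − at and 2y = rt − bs; then
--   2x² = aD + 8,  2y² = bD + 8,  2s = rx + ay,  2t = ry + bx
-- with x, y > 0 (D/2 is the element by which {a,b,c} extends downwards to a
-- D(4)-quadruple).  D < 0 would force y < x < 2; D > 0 forces y > x and then
-- r + s ≤ t.  So in a non-degenerate triangle D = 0, hence x = y = 2, s = r + a
-- and c = a + b + 2r, and t² − s² = (b − a)c.  As r < s < t, only the angle
-- opposite t can fail to be acute.

open import Data.Nat as ℕ using (ℕ)
import Data.Nat.Properties as ℕ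
open import Data.Nat.Divisibility using (_∣_; m∣m*n)
open import Data.Nat.Primality using (euclidsLemma; prime[2])
open import Data.Integer using (ℤ; +_; -[1+_]; 0ℤ; 1ℤ; _+_; _-_; -_; _*_; _^_; _≤_; _<_; _>_;
  ∣_∣; +<+; +≤+; positive; ≢-nonZero; nonNegative)
open import Data.Integer.Properties
open import Data.Integer.Tactic.RingSolver using (solve-∀)
open import Data.Integer.Divisibility.Signed using (∣ᵤ⇒∣; divides)
open import Data.Rational as ℚ using (0ℚ)
import Data.Rational.Properties as ℚ
open import Data.Product using (_×_; _,_; ∃)
open import Data.Sum using (_⊎_; inj₁; inj₂; [_,_]′)
open import Function.Base using (id; _∘_)
open import Function.Bundles using (_⇔_; mk⇔)
open import Relation.Binary.Definitions using (Tri; tri<; tri≈; tri>)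
open import Relation.Binary.PropositionalEquality
open import Relation.Nullary using (¬_; contradiction)
open import Defs

-- Order, squares and parity in the integers.

private variable
  i j k : ℤ

≤-byDifference : 0ℤ ≤ k → j ≡ i + k → i ≤ j
≤-byDifference {k} {i = i} 0≤k refl = subst (_≤ i + k) (+-identityʳ i) (+-monoʳ-≤ i 0≤k)

<-byDifference : 0ℤ < k → j ≡ i + k → i < j
<-byDifference {k} {i = i} 0<k refl = subst (_< i + k) (+-identityʳ i) (+-monoʳ-< i 0<k)

0≤i*j : 0ℤ ≤ i → 0ℤ ≤ j → 0ℤ ≤ i * j
0≤i*j {i} {j} 0≤i 0≤j = subst (_≤ i * j) (*-zeroʳ i) (*-monoˡ-≤-nonNeg i {{nonNegative 0≤i}} 0≤j)

0<i*j : 0ℤ < i → 0ℤ < j → 0ℤ < i * j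
0<i*j {i} {j} 0<i 0<j = subst (_< i * j) (*-zeroʳ i) (*-monoˡ-<-pos i {{positive 0<i}} 0<j)

i<j⇒0<j-i : i < j → 0ℤ < j - i
i<j⇒0<j-i {i} {j} i<j = subst (_< j - i) (+-inverseʳ i) (+-monoˡ-< (- i) i<j)

i<j⇒i-j<0 : i < j → i - j < 0ℤ
i<j⇒i-j<0 {i} {j} i<j = subst (i - j <_) (+-inverseʳ j) (+-monoˡ-< (- j) i<j)

square-mono-≤ : 0ℤ ≤ i → i ≤ j → i * i ≤ j * j
square-mono-≤ {i} {j} 0≤i i≤j = ≤-trans
  (*-monoˡ-≤-nonNeg i {{nonNegative 0≤i}} i≤j)
  (*-monoʳ-≤-nonNeg j {{nonNegative (≤-trans 0≤i i≤j)}} i≤j)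

square-mono-< : 0ℤ ≤ i → i < j → i * i < j * j
square-mono-< {i} {j} 0≤i i<j = ≤-<-trans
  (*-monoˡ-≤-nonNeg i {{nonNegative 0≤i}} (<⇒≤ i<j))
  (*-monoʳ-<-pos j {{positive (≤-<-trans 0≤i i<j)}} i<j)

square-cancel-≤ : 0ℤ ≤ j → i * i ≤ j * j → i ≤ j
square-cancel-≤ 0≤j i²≤j² = ≮⇒≥ λ j<i → ≤⇒≯ i²≤j² (square-mono-< 0≤j j<i)

square-cancel-< : 0ℤ ≤ j → i * i < j * j → i < j
square-cancel-< 0≤j i²<j² = ≰⇒> λ j≤i → <⇒≱ i²<j² (square-mono-≤ 0≤j j≤i)

square-injective : 0ℤ ≤ i → 0ℤ ≤ j → i * i ≡ j * j → i ≡ j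
square-injective 0≤i 0≤j i²≡j² = ≤-antisym
  (square-cancel-≤ 0≤j (≤-reflexive i²≡j²))
  (square-cancel-≤ 0≤i (≤-reflexive (sym i²≡j²)))

-- Euclid's lemma for the prime 2, applied to absolute values. It supplies the halves `x` and `y`.
even-square⇒even : i * i ≡ + 2 * k → ∃ λ j → i ≡ + 2 * j
even-square⇒even {i} {k} i²≡2k with ∣ᵤ⇒∣ {+ 2} {i} 2∣i
  where
  2∣i² : 2 ∣ ∣ i ∣ ℕ.* ∣ i ∣
  2∣i² = subst (2 ∣_)
    (trans (sym (abs-* (+ 2) k)) (trans (cong ∣_∣ (sym i²≡2k)) (abs-* i i)))
    (m∣m*n ∣ k ∣)
  2∣i : 2 ∣ ∣ i ∣
  2∣i = [ id , id ]′ (euclidsLemma ∣ i ∣ ∣ i ∣ prime[2] 2∣i²)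
... | divides q i≡q*2 = q , trans i≡q*2 (*-comm q (+ 2))

-- The quantity `D` and the half roots `x` and `y`.

-- This is `D`; the extending element `a + b + c + (abc − rst)/2` is kept doubled so that no
-- division occurs.
twiceExtension : (a b c r s t : ℤ) → ℤ
twiceExtension a b c r s t = + 2 * (a + b + c) + a * b * c - r * s * t

-- Exchanging `a` with `b` and `s` with `t` turns the results about `x` into those about `y`; `D` is
-- invariant under this exchange.
twiceExtension-swap : ∀ a b c r s t → twiceExtension b a c r t s ≡ twiceExtension a b c r s t
twiceExtension-swap = identity
  where
  identity : ∀ a b c r s t → + 2 * (b + a + c) + b * a * c - r * t * s
                           ≡ + 2 * (a + b + c) + a * b * c - r * s * t
  identity = solve-∀

module _ (a b c r s t : ℤ)
         (r² : r * r ≡ a * b + + 4) (s² : s * s ≡ a * c + + 4) (t² : t * t ≡ b * c + + 4) where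

  private
    D = twiceExtension a b c r s t
    open ≡-Reasoning

  -- After the three squares are replaced, the only root left is the product `rst` in the mixed
  -- term, which is how `D` appears.
  [rs-at]² : (r * s - a * t) * (r * s - a * t) ≡ + 2 * (a * D + + 8)
  [rs-at]² = begin
    (r * s - a * t) * (r * s - a * t)
      ≡⟨ expand a r s t ⟩
    r * r * (s * s) + a * a * (t * t) - + 2 * a * (r * s * t)
      ≡⟨ cong (_- + 2 * a * (r * s * t)) (cong₂ _+_ (cong₂ _*_ r² s²) (cong (a * a *_) t²)) ⟩
    (a * b + + 4) * (a * c + + 4) + a * a * (b * c + + 4) - + 2 * a * (r * s * t)
      ≡⟨ collect a b c (r * s * t) ⟩
    + 2 * (a * D + + 8) ∎
    where
    expand : ∀ a r s t → (r * s - a * t) * (r * s - a * t)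
                       ≡ r * r * (s * s) + a * a * (t * t) - + 2 * a * (r * s * t)
    expand = solve-∀
    collect : ∀ a b c p → (a * b + + 4) * (a * c + + 4) + a * a * (b * c + + 4) - + 2 * a * p
                        ≡ + 2 * (a * (+ 2 * (a + b + c) + a * b * c - p) + + 8)
    collect = solve-∀

  -- The squares differ by `(ab + 4)(ac + 4) − a²(bc + 4) = 4ab + 4a(c − a) +
  -- 16`. Comparing `a` with `c` alone keeps the lemma applicable after `a` and `b` are exchanged.
  at<rs : 0ℤ < a → 0ℤ < b → 0ℤ < c → a < c → 0ℤ < r → 0ℤ < s → a * t < r * s
  at<rs 0<a 0<b 0<c a<c 0<r 0<s =
    square-cancel-< (<⇒≤ (0<i*j 0<r 0<s)) (<-byDifference 0<diff eq)
    where
    0<diff : 0ℤ < + 4 * (a * b) + + 4 * (a * (c - a)) + + 16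
    0<diff = +-mono-< (+-mono-< (0<i*j {+ 4} (+<+ ℕ.z<s) (0<i*j 0<a 0<b))
                                (0<i*j {+ 4} (+<+ ℕ.z<s) (0<i*j 0<a (i<j⇒0<j-i a<c))))
                      (+<+ ℕ.z<s)
    expand : ∀ r s → r * s * (r * s) ≡ r * r * (s * s)
    expand = solve-∀
    split : ∀ a b c → (a * b + + 4) * (a * c + + 4)
                    ≡ a * a * (b * c + + 4) + (+ 4 * (a * b) + + 4 * (a * (c - a)) + + 16)
    split = solve-∀
    collect : ∀ a t e → a * a * (t * t) + e ≡ a * t * (a * t) + e
    collect = solve-∀
    eq : r * s * (r * s) ≡ a * t * (a * t) + (+ 4 * (a * b) + + 4 * (a * (c - a)) + + 16)
    eq = begin
      r * s * (r * s)                    ≡⟨ expand r s ⟩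
      r * r * (s * s)                    ≡⟨ cong₂ _*_ r² s² ⟩
      (a * b + + 4) * (a * c + + 4)      ≡⟨ split a b c ⟩
      a * a * (b * c + + 4) + _          ≡⟨ cong (λ p → a * a * p + _) (sym t²) ⟩
      a * a * (t * t) + _                ≡⟨ collect a t _ ⟩
      a * t * (a * t) + _                ∎

  -- By `[rs-at]²` the number `rs − at` has an even square, so it is even; `at<rs` makes its half
  -- positive.
  halfRoot : 0ℤ < a → 0ℤ < b → 0ℤ < c → a < c → 0ℤ < r → 0ℤ < s →
             ∃ λ x → r * s - a * t ≡ + 2 * x × 0ℤ < x × + 2 * (x * x) ≡ a * D + + 8
  halfRoot 0<a 0<b 0<c a<c 0<r 0<s with even-square⇒even [rs-at]²
  ... | x , X≡2x = x , X≡2x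
    , *-cancelˡ-<-nonNeg (+ 2) (subst (0ℤ <_) X≡2x (i<j⇒0<j-i (at<rs 0<a 0<b 0<c a<c 0<r 0<s)))
    , *-cancelˡ-≡ (+ 2) _ _ (begin
        + 2 * (+ 2 * (x * x))              ≡⟨ regroup x ⟩
        + 2 * x * (+ 2 * x)                ≡⟨ cong₂ _*_ (sym X≡2x) (sym X≡2x) ⟩
        (r * s - a * t) * (r * s - a * t)  ≡⟨ [rs-at]² ⟩
        + 2 * (a * D + + 8)                ∎)
    where
    regroup : ∀ x → + 2 * (+ 2 * (x * x)) ≡ + 2 * x * (+ 2 * x)
    regroup = solve-∀

-- Since `r² − ab = 4`, one has `4s = r²s − abs = r(rs − at) + a(rt − bs)`: adding and subtracting
-- `art` brings in both half roots.
2s≡rx+ay : ∀ a b r s t x y → r * r ≡ a * b + + 4 →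
           r * s - a * t ≡ + 2 * x → r * t - b * s ≡ + 2 * y → + 2 * s ≡ r * x + a * y
2s≡rx+ay a b r s t x y r² X≡2x Y≡2y = *-cancelˡ-≡ (+ 2) _ _ (begin
  + 2 * (+ 2 * s)                              ≡⟨ intro a b s ⟩
  (a * b + + 4) * s - a * b * s                ≡⟨ cong (λ p → p * s - a * b * s) (sym r²) ⟩
  r * r * s - a * b * s                        ≡⟨ split a b r s t ⟩
  r * (r * s - a * t) + a * (r * t - b * s)    ≡⟨ cong₂ (λ p q → r * p + a * q) X≡2x Y≡2y ⟩
  r * (+ 2 * x) + a * (+ 2 * y)                ≡⟨ collect a r x y ⟩
  + 2 * (r * x + a * y)                        ∎)
  where
  open ≡-Reasoning
  intro : ∀ a b s → + 2 * (+ 2 * s) ≡ (a * b + + 4) * s - a * b * s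
  intro = solve-∀
  split : ∀ a b r s t → r * r * s - a * b * s ≡ r * (r * s - a * t) + a * (r * t - b * s)
  split = solve-∀
  collect : ∀ a r x y → r * (+ 2 * x) + a * (+ 2 * y) ≡ + 2 * (r * x + a * y)
  collect = solve-∀

-- Consequences of the sign of `D`.

module _ {a b r x y D : ℤ} (0<a : 0ℤ < a) (a<b : a < b) (0<r : 0ℤ < r)
         (0<x : 0ℤ < x) (0<y : 0ℤ < y)
         (r² : r * r ≡ a * b + + 4)
         (2x² : + 2 * (x * x) ≡ a * D + + 8) (2y² : + 2 * (y * y) ≡ b * D + + 8) where

  private
    0<b : 0ℤ < b
    0<b = <-trans 0<a a<b
    0<b-a : 0ℤ < b - a
    0<b-a = i<j⇒0<j-i a<b

  -- Here `2x² < 8` gives `x ≤ 1`, and `2y² = 2x² + (b − a)D` gives `y < x`; so `y < 1`, against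
  -- `0 < y`.
  D≮0 : ¬ D < 0ℤ
  D≮0 D<0 = <⇒≱ (<-≤-trans y<x (i<j⇒i≤pred[j] x<2)) (i<j⇒suc[i]≤j 0<y)
    where
    neg : 0ℤ < i → i * D < 0ℤ
    neg {i} 0<i = subst (i * D <_) (*-zeroʳ i) (*-monoˡ-<-pos i {{positive 0<i}} D<0)
    x<2 : x < + 2
    x<2 = square-cancel-< (+≤+ ℕ.z≤n) (*-cancelˡ-<-nonNeg (+ 2)
      (subst (_< + 8) (sym 2x²) (+-monoˡ-< (+ 8) (neg 0<a))))
    split : ∀ a b D → a * D + + 8 ≡ b * D + + 8 - (b - a) * D
    split = solve-∀
    y<x : y < x
    y<x = square-cancel-< (<⇒≤ 0<x) (*-cancelˡ-<-nonNeg (+ 2)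
      (subst₂ _<_ (sym 2y²) (sym 2x²)
        (<-byDifference (neg-mono-< (neg 0<b-a)) (split a b D))))

  x<y : 0ℤ < D → x < y
  x<y 0<D = square-cancel-< (<⇒≤ 0<y) (*-cancelˡ-<-nonNeg (+ 2)
    (subst₂ _<_ (sym 2x²) (sym 2y²) (<-byDifference (0<i*j 0<b-a 0<D) (split a b D))))
    where
    split : ∀ a b D → b * D + + 8 ≡ a * D + + 8 + (b - a) * D
    split = solve-∀

  -- Doubled, the squares differ by `b²(aD + 8) − a²(bD + 8) = (b − a)(abD + 8(a + b))`.
  ay≤bx : 0ℤ < D → a * y ≤ b * x
  ay≤bx 0<D = square-cancel-≤ (<⇒≤ (0<i*j 0<b 0<x)) (*-cancelˡ-≤-pos _ _ (+ 2)
    (≤-byDifference 0≤diff (begin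
      + 2 * (b * x * (b * x))     ≡⟨ regroup b x ⟩
      b * b * (+ 2 * (x * x))     ≡⟨ cong (b * b *_) 2x² ⟩
      b * b * (a * D + + 8)       ≡⟨ split a b D ⟩
      a * a * (b * D + + 8) + _   ≡⟨ cong (λ p → a * a * p + _) (sym 2y²) ⟩
      a * a * (+ 2 * (y * y)) + _ ≡⟨ cong (_+ _) (sym (regroup a y)) ⟩
      + 2 * (a * y * (a * y)) + _ ∎)))
    where
    open ≡-Reasoning
    0≤diff : 0ℤ ≤ (b - a) * (a * b * D + + 8 * (a + b))
    0≤diff = <⇒≤ (0<i*j 0<b-a (+-mono-< (0<i*j (0<i*j 0<a 0<b) 0<D)
                                        (0<i*j {+ 8} (+<+ ℕ.z<s) (+-mono-< 0<a 0<b))))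
    regroup : ∀ b x → + 2 * (b * x * (b * x)) ≡ b * b * (+ 2 * (x * x))
    regroup = solve-∀
    split : ∀ a b D → b * b * (a * D + + 8)
                    ≡ a * a * (b * D + + 8) + (b - a) * (a * b * D + + 8 * (a + b))
    split = solve-∀

  -- Multiplying by D expresses everything through x: with u = bx − ay one gets
  -- (Du)² − (Dr)² = 4((4x + 2)² − D²), and (b − a)D = 4x + 2 bounds D by 4x + 2.
  r≤bx-ay : 0ℤ < D → y ≡ 1ℤ + x → r ≤ b * x - a * y
  r≤bx-ay 0<D refl = *-cancelˡ-≤-pos _ _ D {{positive 0<D}}
    (square-cancel-≤ 0≤Du (subst₂ _≤_ (sym [Dr]²) (sym [Du]²)
      (+-monoʳ-≤ (A * B) (*-monoˡ-≤-nonNeg (+ 4) (square-mono-≤ (<⇒≤ 0<D) D≤4x+2)))))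
    where
    open ≡-Reasoning
    u = b * x - a * (1ℤ + x)
    A = + 2 * (x * x) - + 8
    B = + 2 * ((1ℤ + x) * (1ℤ + x)) - + 8
    drop8 : ∀ p → p ≡ p + + 8 - + 8
    drop8 = solve-∀
    aD≡A : a * D ≡ A
    aD≡A = trans (drop8 (a * D)) (cong (_- + 8) (sym 2x²))
    bD≡B : b * D ≡ B
    bD≡B = trans (drop8 (b * D)) (cong (_- + 8) (sym 2y²))
    Du≡ : D * u ≡ + 2 * (x * x) + + 2 * x + + 8
    Du≡ = begin
      D * u                                    ≡⟨ expand a b x D ⟩
      x * (b * D) - (1ℤ + x) * (a * D)         ≡⟨ cong₂ (λ p q → x * p - (1ℤ + x) * q) bD≡B aD≡A ⟩
      x * B - (1ℤ + x) * A                     ≡⟨ collect x ⟩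
      + 2 * (x * x) + + 2 * x + + 8            ∎
      where
      expand : ∀ a b x D → D * (b * x - a * (1ℤ + x)) ≡ x * (b * D) - (1ℤ + x) * (a * D)
      expand = solve-∀
      collect : ∀ x → x * (+ 2 * ((1ℤ + x) * (1ℤ + x)) - + 8) - (1ℤ + x) * (+ 2 * (x * x) - + 8)
                    ≡ + 2 * (x * x) + + 2 * x + + 8
      collect = solve-∀
    0≤Du : 0ℤ ≤ D * u
    0≤Du = subst (0ℤ ≤_) (sym Du≡) (+-mono-≤ (+-mono-≤
      (0≤i*j {+ 2} (+≤+ ℕ.z≤n) (<⇒≤ (0<i*j 0<x 0<x))) (0≤i*j {+ 2} (+≤+ ℕ.z≤n) (<⇒≤ 0<x)))
      (+≤+ ℕ.z≤n))
    [Du]² : D * u * (D * u) ≡ A * B + + 4 * ((+ 4 * x + + 2) * (+ 4 * x + + 2))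
    [Du]² = trans (cong₂ _*_ Du≡ Du≡) (expand x)
      where
      expand : ∀ x → (+ 2 * (x * x) + + 2 * x + + 8) * (+ 2 * (x * x) + + 2 * x + + 8)
                   ≡ (+ 2 * (x * x) - + 8) * (+ 2 * ((1ℤ + x) * (1ℤ + x)) - + 8)
                     + + 4 * ((+ 4 * x + + 2) * (+ 4 * x + + 2))
      expand = solve-∀
    [Dr]² : D * r * (D * r) ≡ A * B + + 4 * (D * D)
    [Dr]² = begin
      D * r * (D * r)                     ≡⟨ regroup D r ⟩
      D * D * (r * r)                     ≡⟨ cong (D * D *_) r² ⟩
      D * D * (a * b + + 4)               ≡⟨ expand a b D ⟩
      a * D * (b * D) + + 4 * (D * D)     ≡⟨ cong (_+ + 4 * (D * D)) (cong₂ _*_ aD≡A bD≡B) ⟩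
      A * B + + 4 * (D * D)               ∎
      where
      regroup : ∀ D r → D * r * (D * r) ≡ D * D * (r * r)
      regroup = solve-∀
      expand : ∀ a b D → D * D * (a * b + + 4) ≡ a * D * (b * D) + + 4 * (D * D)
      expand = solve-∀
    D≤4x+2 : D ≤ + 4 * x + + 2
    D≤4x+2 = ≤-byDifference (0≤i*j (i≤j⇒0≤j-i (i<j⇒suc[i]≤j 0<b-a)) (<⇒≤ 0<D)) (begin
      + 4 * x + + 2                ≡⟨ expand x ⟩
      B - A                        ≡⟨ cong₂ _-_ (sym bD≡B) (sym aD≡A) ⟩
      b * D - a * D                ≡⟨ split a b D ⟩
      D + (b - a - 1ℤ) * D         ∎)
      where
      expand : ∀ x → + 4 * x + + 2 ≡ (+ 2 * ((1ℤ + x) * (1ℤ + x)) - + 8) - (+ 2 * (x * x) - + 8)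
      expand = solve-∀
      split : ∀ a b D → b * D - a * D ≡ D + (b - a - 1ℤ) * D
      split = solve-∀

  -- The difference `2t − 2(r + s)` equals `r(y − x − 2) + (bx − ay)`. Its first term is negative
  -- only when `y = x + 1`, as `x < y`.
  r+s≤t : ∀ {s t} → + 2 * s ≡ r * x + a * y → + 2 * t ≡ r * y + b * x → 0ℤ < D → r + s ≤ t
  r+s≤t {s} {t} 2s 2t 0<D = *-cancelˡ-≤-pos _ _ (+ 2) (≤-byDifference 0≤diff (begin
    + 2 * t                                                    ≡⟨ 2t ⟩
    r * y + b * x                                              ≡⟨ split a b r x y ⟩
    + 2 * r + (r * x + a * y) + _                              ≡⟨ cong (λ p → + 2 * r + p + _) (sym 2s) ⟩
    + 2 * r + + 2 * s + _                                      ≡⟨ cong (_+ _) (sym (*-distribˡ-+ (+ 2) r s)) ⟩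
    + 2 * (r + s) + (r * (y - x - + 2) + (b * x - a * y))      ∎))
    where
    open ≡-Reasoning
    split : ∀ a b r x y → r * y + b * x
                        ≡ + 2 * r + (r * x + a * y) + (r * (y - x - + 2) + (b * x - a * y))
    split = solve-∀
    0≤diff : 0ℤ ≤ r * (y - x - + 2) + (b * x - a * y)
    0≤diff with <-cmp (1ℤ + x) y
    -- Now `y ≥ x + 2`, and both terms are nonnegative separately.
    ... | tri< 1+x<y _ _ = +-mono-≤
      (0≤i*j (<⇒≤ 0<r) (subst (0ℤ ≤_) (regroup x y) (i≤j⇒0≤j-i (i<j⇒suc[i]≤j 1+x<y))))
      (i≤j⇒0≤j-i (ay≤bx 0<D))
      where
      regroup : ∀ x y → y - (1ℤ + (1ℤ + x)) ≡ y - x - + 2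
      regroup = solve-∀
    -- The first term is exactly `−r`, which the sharper bound `r≤bx-ay` compensates.
    ... | tri≈ _ 1+x≡y _ = subst (0ℤ ≤_)
      (trans (regroup r x (b * x - a * y)) (cong (λ p → r * (p - x - + 2) + (b * x - a * y)) 1+x≡y))
      (i≤j⇒0≤j-i (r≤bx-ay 0<D (sym 1+x≡y)))
      where
      regroup : ∀ r x u → u - r ≡ r * (1ℤ + x - x - + 2) + u
      regroup = solve-∀
    ... | tri> _ _ y<1+x = contradiction (i<j⇒suc[i]≤j (x<y 0<D)) (<⇒≱ y<1+x)

  D≡0⇒s≡r+a : ∀ {s} → + 2 * s ≡ r * x + a * y → D ≡ 0ℤ → s ≡ r + a
  D≡0⇒s≡r+a {s} 2s D≡0 = *-cancelˡ-≡ (+ 2) _ _ (begin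
    + 2 * s               ≡⟨ 2s ⟩
    r * x + a * y         ≡⟨ cong₂ (λ p q → r * p + a * q) (root a 0<x 2x²) (root b 0<y 2y²) ⟩
    r * + 2 + a * + 2     ≡⟨ collect a r ⟩
    + 2 * (r + a)         ∎)
    where
    open ≡-Reasoning
    collect : ∀ a r → r * + 2 + a * + 2 ≡ + 2 * (r + a)
    collect = solve-∀
    -- With `D = 0` the equation reads `2z² = 8`, whatever the coefficient `i`, so it serves for
    -- both `x` and `y`.
    root : ∀ i {z} → 0ℤ < z → + 2 * (z * z) ≡ i * D + + 8 → z ≡ + 2
    root i 0<z 2z² = square-injective (<⇒≤ 0<z) (+≤+ ℕ.z≤n) (*-cancelˡ-≡ (+ 2) _ _
      (trans 2z² (cong (_+ + 8) (trans (cong (i *_) D≡0) (*-zeroʳ i)))))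

-- Nondegenerate triangles over the integers.

module _ {a b c r s t : ℤ} (0<a : 0ℤ < a) (a<b : a < b) (b<c : b < c)
         (0<r : 0ℤ < r) (0<s : 0ℤ < s) (0<t : 0ℤ < t)
         (r² : r * r ≡ a * b + + 4) (s² : s * s ≡ a * c + + 4) (t² : t * t ≡ b * c + + 4) where

  private
    0<b : 0ℤ < b
    0<b = <-trans 0<a a<b
    0<c : 0ℤ < c
    0<c = <-trans 0<b b<c
    D : ℤ
    D = twiceExtension a b c r s t
    r²≡ba+4 : r * r ≡ b * a + + 4
    r²≡ba+4 = trans r² (cong (_+ + 4) (*-comm a b))

  nondegenerate⇒s≡r+a : t < r + s → s ≡ r + a
  nondegenerate⇒s≡r+a t<r+s = fromHalves
    (halfRoot a b c r s t r² s² t² 0<a 0<b 0<c (<-trans a<b b<c) 0<r 0<s)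
    -- The same lemma with `a`, `b` and `s`, `t` exchanged produces `y`.
    (halfRoot b a c r t s r²≡ba+4 t² s² 0<b 0<a 0<c b<c 0<r 0<t)
    where
    fromHalves :
      (∃ λ x → r * s - a * t ≡ + 2 * x × 0ℤ < x × + 2 * (x * x) ≡ a * D + + 8) →
      (∃ λ y → r * t - b * s ≡ + 2 * y × 0ℤ < y ×
               + 2 * (y * y) ≡ b * twiceExtension b a c r t s + + 8) →
      s ≡ r + a
    fromHalves (x , X≡2x , 0<x , 2x²) (y , Y≡2y , 0<y , 2y²′) = byCases (<-cmp D 0ℤ)
      where
      2y² : + 2 * (y * y) ≡ b * D + + 8
      2y² = trans 2y²′ (cong (λ p → b * p + + 8) (twiceExtension-swap a b c r s t))
      2s : + 2 * s ≡ r * x + a * y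
      2s = 2s≡rx+ay a b r s t x y r² X≡2x Y≡2y
      2t : + 2 * t ≡ r * y + b * x
      2t = 2s≡rx+ay b a r t s y x r²≡ba+4 Y≡2y X≡2x
      byCases : Tri (D < 0ℤ) (D ≡ 0ℤ) (D > 0ℤ) → s ≡ r + a
      byCases (tri< D<0 _ _) = contradiction D<0 (D≮0 0<a a<b 0<r 0<x 0<y r² 2x² 2y²)
      byCases (tri≈ _ D≡0 _) = D≡0⇒s≡r+a 0<a a<b 0<r 0<x 0<y r² 2x² 2y² 2s D≡0
      byCases (tri> _ _ D>0) =
        contradiction (r+s≤t 0<a a<b 0<r 0<x 0<y r² 2x² 2y² 2s 2t D>0) (<⇒≱ t<r+s)

  -- Squaring `s = r + a` gives `ac + 4 = ab + 4 + 2ra + a²`; then `a` cancels.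
  nondegenerate⇒c≡2r+a+b : t < r + s → c ≡ + 2 * r + a + b
  nondegenerate⇒c≡2r+a+b t<r+s = *-cancelˡ-≡ a _ _ {{≢-nonZero (<⇒≢ 0<a ∘ sym)}} (begin
    a * c                                     ≡⟨ drop4 (a * c) ⟩
    a * c + + 4 - + 4                         ≡⟨ cong (_- + 4) (sym s²) ⟩
    s * s - + 4                               ≡⟨ cong (λ p → p * p - + 4) (nondegenerate⇒s≡r+a t<r+s) ⟩
    (r + a) * (r + a) - + 4                   ≡⟨ expand a r ⟩
    r * r + (+ 2 * r * a + a * a) - + 4       ≡⟨ cong (λ p → p + (+ 2 * r * a + a * a) - + 4) r² ⟩
    a * b + + 4 + (+ 2 * r * a + a * a) - + 4 ≡⟨ collect a b r ⟩
    a * (+ 2 * r + a + b)                     ∎)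
    where
    open ≡-Reasoning
    drop4 : ∀ p → p ≡ p + + 4 - + 4
    drop4 = solve-∀
    expand : ∀ a r → (r + a) * (r + a) - + 4 ≡ r * r + (+ 2 * r * a + a * a) - + 4
    expand = solve-∀
    collect : ∀ a b r → a * b + + 4 + (+ 2 * r * a + a * a) - + 4 ≡ a * (+ 2 * r + a + b)
    collect = solve-∀

  r²<s² : r * r < s * s
  r²<s² = subst₂ _<_ (sym r²) (sym s²)
    (+-monoˡ-< (+ 4) (*-monoˡ-<-pos a {{positive 0<a}} b<c))

  s²<t² : s * s < t * t
  s²<t² = subst₂ _<_ (sym s²) (sym t²)
    (+-monoˡ-< (+ 4) (*-monoʳ-<-pos c {{positive 0<c}} a<b))

  -- The constants cancel in `s² − t² = −(b − a)c`, and nondegeneracy determines `c`.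
  r²+s²-t² : t < r + s →
             r ^ 2 + s ^ 2 - t ^ 2 ≡ r ^ 2 - (b - a) * (+ 2 * r + a + b)
  r²+s²-t² t<r+s = begin
    r ^ 2 + s ^ 2 - t ^ 2                    ≡⟨ unfold r s t ⟩
    r ^ 2 + s * s - t * t                    ≡⟨ cong₂ (λ p q → r ^ 2 + p - q) s² t² ⟩
    r ^ 2 + (a * c + + 4) - (b * c + + 4)    ≡⟨ collect (r ^ 2) a b c ⟩
    r ^ 2 - (b - a) * c                      ≡⟨ cong (λ p → r ^ 2 - (b - a) * p) (nondegenerate⇒c≡2r+a+b t<r+s) ⟩
    r ^ 2 - (b - a) * (+ 2 * r + a + b)      ∎
    where
    open ≡-Reasoning
    -- `r ^ 2` computes to `r * (r * 1ℤ)`, the form used here.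
    unfold : ∀ r s t → r * (r * 1ℤ) + s * (s * 1ℤ) - t * (t * 1ℤ) ≡ r * (r * 1ℤ) + s * s - t * t
    unfold = solve-∀
    collect : ∀ p a b c → p + (a * c + + 4) - (b * c + + 4) ≡ p - (b - a) * c
    collect = solve-∀

-- Signs of cosines and the types of angle.

0<i⇒0<i/n : ∀ i n .{{_ : ℕ.NonZero n}} → 0ℤ < i → 0ℚ ℚ.< i ℚ./ n
0<i⇒0<i/n (+ ℕ.suc m) n _ = ℚ.positive⁻¹ _ {{ℚ.normalize-pos (ℕ.suc m) n}}
0<i⇒0<i/n (+ 0) n (+<+ ())

i≡0⇒i/n≡0 : ∀ i n .{{_ : ℕ.NonZero n}} → i ≡ 0ℤ → i ℚ./ n ≡ 0ℚ
i≡0⇒i/n≡0 _ n refl = ℚ.0/n≡0 n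

i<0⇒i/n<0 : ∀ i n .{{_ : ℕ.NonZero n}} → i < 0ℤ → i ℚ./ n ℚ.< 0ℚ
-- This fraction computes to the negation of a positive one.
i<0⇒i/n<0 -[1+ m ] n _ =
  ℚ.neg-antimono-< (ℚ.positive⁻¹ _ {{ℚ.normalize-pos (ℕ.suc m) n}})
i<0⇒i/n<0 (+ m) n (+<+ ())

module _ {x y z : ℕ} (T : IsTriangle x y z) where
  open IsTriangle T

  module _ (0<cosX : 0ℚ ℚ.< cosX) (0<cosY : 0ℚ ℚ.< cosY) where

    -- With the angles at `X` and `Y` acute, the type of the triangle is decided by `cosZ` alone;
    -- mutual exclusion of the three types then follows from the order on ℚ.
    right⇒cosZ≡0 : Right T → cosZ ≡ 0ℚ
    right⇒cosZ≡0 (inj₁ cosX≡0)        = contradiction 0<cosX (ℚ.<-irrefl (sym cosX≡0))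
    right⇒cosZ≡0 (inj₂ (inj₁ cosY≡0)) = contradiction 0<cosY (ℚ.<-irrefl (sym cosY≡0))
    right⇒cosZ≡0 (inj₂ (inj₂ cosZ≡0)) = cosZ≡0

    obtuse⇒cosZ<0 : Obtuse T → cosZ ℚ.< 0ℚ
    obtuse⇒cosZ<0 (inj₁ cosX<0)        = contradiction cosX<0 (ℚ.<-asym 0<cosX)
    obtuse⇒cosZ<0 (inj₂ (inj₁ cosY<0)) = contradiction cosY<0 (ℚ.<-asym 0<cosY)
    obtuse⇒cosZ<0 (inj₂ (inj₂ cosZ<0)) = cosZ<0

    acute∧right⇒⊥ : ¬ (Acute T × Right T)
    acute∧right⇒⊥ ((_ , _ , 0<cosZ) , R) = ℚ.<-irrefl (sym (right⇒cosZ≡0 R)) 0<cosZ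

    acute∧obtuse⇒⊥ : ¬ (Acute T × Obtuse T)
    acute∧obtuse⇒⊥ ((_ , _ , 0<cosZ) , O) = ℚ.<-asym 0<cosZ (obtuse⇒cosZ<0 O)

    right∧obtuse⇒⊥ : ¬ (Right T × Obtuse T)
    right∧obtuse⇒⊥ (R , O) = ℚ.<-irrefl (right⇒cosZ≡0 R) (obtuse⇒cosZ<0 O)

-- The order cases are exhaustive and `A`, `R`, `O` exclude one another, so the three implications
-- from the order determine their converses.
exactlyOne-trichotomy : ∀ {A R O : Set} (i j : ℤ) →
  (i > j → A) → (i ≡ j → R) → (i < j → O) →
  ¬ (A × R) → ¬ (A × O) → ¬ (R × O) →
  ExactlyOne A R O × (A ⇔ i > j) × (R ⇔ i ≡ j) × (O ⇔ i < j)
exactlyOne-trichotomy {A} {R} {O} i j f g h ¬AR ¬AO ¬RO =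
  (cover , ¬AR , ¬AO , ¬RO) , mk⇔ f⁻¹ f , mk⇔ g⁻¹ g , mk⇔ h⁻¹ h
  where
  cover : A ⊎ R ⊎ O
  cover with <-cmp i j
  ... | tri< i<j _ _ = inj₂ (inj₂ (h i<j))
  ... | tri≈ _ i≡j _ = inj₂ (inj₁ (g i≡j))
  ... | tri> _ _ i>j = inj₁ (f i>j)
  f⁻¹ : A → i > j
  f⁻¹ p with <-cmp i j
  ... | tri< i<j _ _ = contradiction (p , h i<j) ¬AO
  ... | tri≈ _ i≡j _ = contradiction (p , g i≡j) ¬AR
  ... | tri> _ _ i>j = i>j
  g⁻¹ : R → i ≡ j
  g⁻¹ q with <-cmp i j
  ... | tri< i<j _ _ = contradiction (q , h i<j) ¬RO
  ... | tri≈ _ i≡j _ = i≡j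
  ... | tri> _ _ i>j = contradiction (f i>j , q) ¬AR
  h⁻¹ : O → i < j
  h⁻¹ o with <-cmp i j
  ... | tri< i<j _ _ = i<j
  ... | tri≈ _ i≡j _ = contradiction (g i≡j , o) ¬RO
  ... | tri> _ _ i>j = contradiction (f i>j , o) ¬AO

-- Passage from natural numbers to the integers, and the theorem.

square+4-toℤ : ∀ m n k → k ℕ.^ 2 ≡ m ℕ.* n ℕ.+ 4 → + k * + k ≡ + m * + n + + 4
square+4-toℤ m n k k² = begin
  + k * + k            ≡⟨ sym (pos-* k k) ⟩
  + (k ℕ.* k)          ≡⟨ cong (λ p → + (k ℕ.* p)) (sym (ℕ.*-identityʳ k)) ⟩
  + (k ℕ.^ 2)          ≡⟨ cong +_ k² ⟩
  + (m ℕ.* n) + + 4    ≡⟨ cong (_+ + 4) (pos-* m n) ⟩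
  + m * + n + + 4      ∎
  where open ≡-Reasoning

corollary4p3 : (a b c r s t : ℕ) → a ℕ.< b → b ℕ.< c → IsD4Triple a b c →
    r ℕ.^ 2 ≡ a ℕ.* b ℕ.+ 4 →
    s ℕ.^ 2 ≡ a ℕ.* c ℕ.+ 4 →
    t ℕ.^ 2 ≡ b ℕ.* c ℕ.+ 4 →
    (T : IsTriangle r s t) →
    ((+ r) ^ 2 + (+ s) ^ 2 - (+ t) ^ 2
    ≡ (+ r) ^ 2 - (+ b - + a) * (+ 2 * + r + + a + + b))
    × ExactlyOne (Acute T) (Right T) (Obtuse T)
    × (Acute T ⇔ ((+ r) ^ 2 > (+ b - + a) * (+ 2 * + r + + a + + b)))
    × (Right T ⇔ ((+ r) ^ 2 ≡ (+ b - + a) * (+ 2 * + r + + a + + b)))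
    × (Obtuse T ⇔ ((+ r) ^ 2 < (+ b - + a) * (+ 2 * + r + + a + + b)))
corollary4p3 a b c r s t a<b b<c D4 r² s² t² T =
  identity , exactlyOne-trichotomy ((+ r) ^ 2) w
    -- The numerator of `cosZ` is `r² + s² − t²`, which `identity` turns into `r² − w`.
    (λ r²>w → 0<cosX , 0<cosY , 0<i⇒0<i/n _ (2 ℕ.* (r ℕ.* s)) (subst (0ℤ <_) (sym identity) (i<j⇒0<j-i r²>w)))
    (λ r²≡w → inj₂ (inj₂ (i≡0⇒i/n≡0 _ (2 ℕ.* (r ℕ.* s)) (trans identity (i≡j⇒i-j≡0 r²≡w)))))
    (λ r²<w → inj₂ (inj₂ (i<0⇒i/n<0 _ (2 ℕ.* (r ℕ.* s)) (subst (_< 0ℤ) (sym identity)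
      (i<j⇒i-j<0 r²<w)))))
    (acute∧right⇒⊥ T 0<cosX 0<cosY) (acute∧obtuse⇒⊥ T 0<cosX 0<cosY) (right∧obtuse⇒⊥ T 0<cosX 0<cosY)
  where
  open IsTriangle T
  -- The corresponding instances in `cosine` are local to it. Since `ℚ./` takes this proof
  -- irrelevantly, the quotients agree.
  instance
    2st≢0 : ℕ.NonZero (2 ℕ.* (s ℕ.* t))
    2st≢0 = ℕ.m*n≢0 2 (s ℕ.* t) {{_}} {{ℕ.m*n≢0 s t}}
    2rt≢0 : ℕ.NonZero (2 ℕ.* (r ℕ.* t))
    2rt≢0 = ℕ.m*n≢0 2 (r ℕ.* t) {{_}} {{ℕ.m*n≢0 r t}}
    2rs≢0 : ℕ.NonZero (2 ℕ.* (r ℕ.* s))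
    2rs≢0 = ℕ.m*n≢0 2 (r ℕ.* s) {{_}} {{ℕ.m*n≢0 r s}}
  w = (+ b - + a) * (+ 2 * + r + + a + + b)
  0<a : 0ℤ < + a
  0<a = +<+ (IsD4Triple.a>0 D4)
  0<pos : ∀ n .{{_ : ℕ.NonZero n}} → 0ℤ < + n
  0<pos n = +<+ (ℕ.>-nonZero⁻¹ n)
  R = square+4-toℤ a b r r²
  S = square+4-toℤ a c s s²
  U = square+4-toℤ b c t t²
  identity : (+ r) ^ 2 + (+ s) ^ 2 - (+ t) ^ 2 ≡ (+ r) ^ 2 - w
  identity = r²+s²-t² 0<a (+<+ a<b) (+<+ b<c) (0<pos r) (0<pos s) (0<pos t) R S U (+<+ z<x+y)
  R<S : + r * + r < + s * + s
  R<S = r²<s² 0<a (+<+ a<b) (+<+ b<c) (0<pos r) (0<pos s) (0<pos t) R S U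
  S<U : + s * + s < + t * + t
  S<U = s²<t² 0<a (+<+ a<b) (+<+ b<c) (0<pos r) (0<pos s) (0<pos t) R S U
  -- The numerator is `s² + (t² − r²)`, a sum of two positive terms because `r < s < t`; for `cosY`
  -- it is `r² + (t² − s²)`.
  0<cosX : 0ℚ ℚ.< cosX
  0<cosX = 0<i⇒0<i/n _ (2 ℕ.* (s ℕ.* t)) (subst (0ℤ <_) (regroup (+ r) (+ s) (+ t))
    (+-mono-< (0<i*j (0<pos s) (0<pos s)) (i<j⇒0<j-i (<-trans R<S S<U))))
    where
    regroup : ∀ r s t → s * s + (t * t - r * r) ≡ s * (s * 1ℤ) + t * (t * 1ℤ) - r * (r * 1ℤ)
    regroup = solve-∀
  0<cosY : 0ℚ ℚ.< cosY
  0<cosY = 0<i⇒0<i/n _ (2 ℕ.* (r ℕ.* t)) (subst (0ℤ <_) (regroup (+ r) (+ s) (+ t))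
    (+-mono-< (0<i*j (0<pos r) (0<pos r)) (i<j⇒0<j-i S<U)))
    where
    regroup : ∀ r s t → r * r + (t * t - s * s) ≡ r * (r * 1ℤ) + t * (t * 1ℤ) - s * (s * 1ℤ)
    regroup = solve-∀
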